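{- Let $P$ be almost a join-based lattice. Suppose $P$ has reduced integral homology in dimension $k\geq 0$, that is, $\widetilde H_k(\Delta(P);\mathbb{Z})\neq 0$. Then there are at least $(k+2)!$ maximal chains in $P$ of length at least $k$.
   Context: All posets are finite. A finite poset $P$ is almost a join-based lattice if, after adjoining a new topmost element $\hat 1$ (strictly above every element of $P$, adjoined even if $P$ already has a greatest element), the poset $P\cup\{\hat 1\}$ is a join semi-lattice, i.e. every two elements have a least upper bound. $\Delta(P)$ is the order complex of $P$: the simplicial complex whose simplices are the chains (totally ordered subsets) of $P$. The length of a chain is one less than its number of elements. $\widetilde H_k$ denotes reduced simplicial homology. -}

module Defs where

open import Algebra.Bundles using (AbelianGroup)
open import Algebra.Core using (Op₂)
open import Algebra.Properties.CommutativeMonoid.Sum as Sum using ()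
open import Algebra.Properties.AbelianGroup as AbelianGroupProperties using ()
open import Data.Bool.Base using (true; false; if_then_else_)
open import Data.Fin.Base using (Fin)
open import Data.Fin.Properties using (_<?_)
open import Data.Fin.Subset using (Subset; ⊥; ⁅_⁆; _∈_; _⊆_; _∩_; _∪_; ∣_∣)
open import Data.Fin.Subset.Properties using (∉⊥)
open import Data.Integer.Base using (ℤ; 0ℤ; 1ℤ; -1ℤ; -_; _+_; _*_; _^_; _⊖_)
open import Data.Integer.Properties as ℤ using ()
open import Data.Integer.Tactic.RingSolver using (solve-∀)
open import Data.Nat.Base as ℕ using (ℕ; suc)
open import Data.Product.Base using (∃; _×_; _,_)
open import Data.Sum.Base using (_⊎_)
open import Data.Vec.Base using (lookup; tabulate)
open import Function.Base using (_∘_)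
open import Level using (Level; _⊔_)
import Level
open import Relation.Binary.Core using (Rel)
open import Relation.Binary.Construct.Add.Supremum.NonStrict as AddTop using ()
open import Relation.Binary.Lattice.Structures using (IsJoinSemilattice)
open import Relation.Binary.PropositionalEquality
  using (_≡_; _≢_; _≗_; refl; sym; trans; cong; cong₂; module ≡-Reasoning)
open import Relation.Nullary.Construct.Add.Supremum using (_⁺)
open import Relation.Nullary.Decidable.Core using (does; yes; no)
open import Relation.Nullary.Negation.Core using (¬_; contradiction)

private
  variable
    n : ℕ
    ℓ : Level

-- The empty set counts as a simplex (of dimension -1), and not every element
-- of Fin n has to be a vertex.
record SimplicialComplex (n : ℕ) (ℓ : Level) : Set (Level.suc ℓ) where
  field
    IsSimplex : Subset n → Set ℓ
    ∅-simplex : IsSimplex ⊥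
    ⊆-closed  : ∀ {σ τ} → σ ⊆ τ → IsSimplex τ → IsSimplex σ

open Sum ℤ.+-0-commutativeMonoid
  using (sum; sum-syntax; ∑-distrib-+; sum-cong-≗; sum-replicate-zero)

below : Fin n → Subset n
below v = tabulate (λ u → does (u <? v))

-- Every simplex is oriented by the order of Fin n on its vertices, and a
-- simplicial chain is given by its coefficients.  In
--   ∂[v₀,…,vₖ] = Σᵢ (-1)ⁱ [v₀,…,v̂ᵢ,…,vₖ]
-- the simplices with σ as a face are the σ ∪ {v} with v ∉ σ, and the position
-- of v in σ ∪ {v} is the number of vertices of σ below v.  For σ = ∅ this is
-- the augmentation.
∂ : (Subset n → ℤ) → (Subset n → ℤ)
∂ {n} c σ = ∑[ v < n ]
  (if lookup σ v then 0ℤ else (-1ℤ ^ ∣ σ ∩ below v ∣) * c (σ ∪ ⁅ v ⁆))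

∂-cong : {c d : Subset n → ℤ} → c ≗ d → ∂ c ≗ ∂ d
∂-cong {n} {c} {d} c≗d σ = sum-cong-≗ {n} term
  where
  term : ∀ v →
    (if lookup σ v then 0ℤ else (-1ℤ ^ ∣ σ ∩ below v ∣) * c (σ ∪ ⁅ v ⁆)) ≡
    (if lookup σ v then 0ℤ else (-1ℤ ^ ∣ σ ∩ below v ∣) * d (σ ∪ ⁅ v ⁆))
  term v with lookup σ v
  ... | true  = refl
  ... | false = cong ((-1ℤ ^ ∣ σ ∩ below v ∣) *_) (c≗d (σ ∪ ⁅ v ⁆))

∂-+ : (c d : Subset n → ℤ) → ∂ (λ σ → c σ + d σ) ≗ λ σ → ∂ c σ + ∂ d σ
∂-+ {n} c d σ = trans (sum-cong-≗ {n} term) (∑-distrib-+ {n} _ _)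
  where
  term : ∀ v →
    (if lookup σ v then 0ℤ
     else (-1ℤ ^ ∣ σ ∩ below v ∣) * (c (σ ∪ ⁅ v ⁆) + d (σ ∪ ⁅ v ⁆))) ≡
    (if lookup σ v then 0ℤ else (-1ℤ ^ ∣ σ ∩ below v ∣) * c (σ ∪ ⁅ v ⁆)) +
    (if lookup σ v then 0ℤ else (-1ℤ ^ ∣ σ ∩ below v ∣) * d (σ ∪ ⁅ v ⁆))
  term v with lookup σ v
  ... | true  = refl
  ... | false = ℤ.*-distribˡ-+ (-1ℤ ^ ∣ σ ∩ below v ∣) _ _

∂-0 : ∂ {n} (λ _ → 0ℤ) ≗ λ _ → 0ℤ
∂-0 {n} σ = trans (sum-cong-≗ {n} term) (sum-replicate-zero n)
  where
  term : ∀ v → (if lookup σ v then 0ℤ else (-1ℤ ^ ∣ σ ∩ below v ∣) * 0ℤ) ≡ 0ℤ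
  term v with lookup σ v
  ... | true  = refl
  ... | false = ℤ.*-zeroʳ (-1ℤ ^ ∣ σ ∩ below v ∣)

∂-neg : (c : Subset n → ℤ) → ∂ (λ σ → - c σ) ≗ λ σ → - ∂ c σ
∂-neg c σ = AbelianGroupProperties.inverseʳ-unique ℤ.+-0-abelianGroup (∂ c σ) (∂ (-_ ∘ c) σ) (begin
  ∂ c σ + ∂ (-_ ∘ c) σ      ≡⟨ ∂-+ c (-_ ∘ c) σ ⟨
  ∂ (λ τ → c τ + - c τ) σ   ≡⟨ ∂-cong (ℤ.+-inverseʳ ∘ c) σ ⟩
  ∂ (λ _ → 0ℤ) σ            ≡⟨ ∂-0 σ ⟩
  0ℤ                        ∎)
  where open ≡-Reasoning

module _ (K : SimplicialComplex n ℓ) where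
  open SimplicialComplex K

  -- The free abelian group on the k-simplices, which have suc k vertices.
  record SimplicialChain (k : ℕ) : Set ℓ where
    field
      coeff     : Subset n → ℤ
      supported : ∀ σ → coeff σ ≢ 0ℤ → IsSimplex σ × ∣ σ ∣ ≡ suc k

  open SimplicialChain

  record Cycle (k : ℕ) : Set ℓ where
    field
      chain  : SimplicialChain k
      closed : ∀ σ → ∂ (coeff chain) σ ≡ 0ℤ
    open SimplicialChain chain public using () renaming (coeff to coefficient)

  open Cycle

  Homologous : ∀ {k} → Rel (Cycle k) ℓ
  Homologous {k} y z = ∃ λ (w : SimplicialChain (suc k)) →
    ∀ σ → coefficient y σ ≡ coefficient z σ + ∂ (coeff w) σ

  0-chain : ∀ {k} → SimplicialChain k
  0-chain .coeff     _     = 0ℤ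
  0-chain .supported _ 0≢0 = contradiction refl 0≢0

  +-chain : ∀ {k} → Op₂ (SimplicialChain k)
  +-chain c d .coeff     σ       = coeff c σ + coeff d σ
  +-chain c d .supported σ c+d≢0 with coeff c σ ℤ.≟ 0ℤ
  ... | no  c≢0 = supported c σ c≢0
  ... | yes c≡0 = supported d σ λ d≡0 → c+d≢0 (cong₂ _+_ c≡0 d≡0)

  neg-chain : ∀ {k} → SimplicialChain k → SimplicialChain k
  neg-chain c .coeff     σ      = - coeff c σ
  neg-chain c .supported σ -c≢0 = supported c σ λ c≡0 → -c≢0 (cong -_ c≡0)

  0-cycle : ∀ {k} → Cycle k
  0-cycle .chain  = 0-chain
  0-cycle .closed = ∂-0

  +-cycle : ∀ {k} → Op₂ (Cycle k)
  +-cycle y z .chain    = +-chain (chain y) (chain z)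
  +-cycle y z .closed σ =
    trans (∂-+ (coefficient y) (coefficient z) σ) (cong₂ _+_ (closed y σ) (closed z σ))

  neg-cycle : ∀ {k} → Cycle k → Cycle k
  neg-cycle z .chain    = neg-chain (chain z)
  neg-cycle z .closed σ = trans (∂-neg (coefficient z) σ) (cong -_ (closed z σ))

  ≗⇒homologous : ∀ {k} (y z : Cycle k) → coefficient y ≗ coefficient z → Homologous y z
  ≗⇒homologous y z y≗z = 0-chain , λ σ → begin
    coefficient y σ                   ≡⟨ y≗z σ ⟩
    coefficient z σ                   ≡⟨ ℤ.+-identityʳ _ ⟨
    coefficient z σ + 0ℤ              ≡⟨ cong (coefficient z σ +_) (∂-0 σ) ⟨
    coefficient z σ + ∂ (λ _ → 0ℤ) σ  ∎
    where open ≡-Reasoning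

  homologous-sym : ∀ {k} {y z : Cycle k} → Homologous y z → Homologous z y
  homologous-sym {y = y} {z} (w , y≡z+∂w) = neg-chain w , λ σ → begin
    coefficient z σ
      ≡⟨ cancel (coefficient z σ) (∂ (coeff w) σ) ⟩
    (coefficient z σ + ∂ (coeff w) σ) + - ∂ (coeff w) σ
      ≡⟨ cong₂ _+_ (y≡z+∂w σ) (∂-neg (coeff w) σ) ⟨
    coefficient y σ + ∂ (-_ ∘ coeff w) σ
      ∎
    where
    open ≡-Reasoning
    cancel : ∀ a b → a ≡ (a + b) + - b
    cancel = solve-∀

  homologous-trans : ∀ {k} {x y z : Cycle k} →
                     Homologous x y → Homologous y z → Homologous x z
  homologous-trans {x = x} {y} {z} (v , x≡y+∂v) (w , y≡z+∂w) = +-chain w v , λ σ → begin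
    coefficient x σ
      ≡⟨ x≡y+∂v σ ⟩
    coefficient y σ + ∂ (coeff v) σ
      ≡⟨ cong (_+ ∂ (coeff v) σ) (y≡z+∂w σ) ⟩
    (coefficient z σ + ∂ (coeff w) σ) + ∂ (coeff v) σ
      ≡⟨ ℤ.+-assoc (coefficient z σ) _ _ ⟩
    coefficient z σ + (∂ (coeff w) σ + ∂ (coeff v) σ)
      ≡⟨ cong (coefficient z σ +_) (∂-+ (coeff w) (coeff v) σ) ⟨
    coefficient z σ + ∂ (coeff (+-chain w v)) σ
      ∎
    where open ≡-Reasoning

  +-homologous : ∀ {k} {x y u v : Cycle k} →
                 Homologous x y → Homologous u v → Homologous (+-cycle x u) (+-cycle y v)
  +-homologous {x = x} {y} {u} {v} (a , x≡y+∂a) (b , u≡v+∂b) = +-chain a b , λ σ → begin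
    coefficient x σ + coefficient u σ
      ≡⟨ cong₂ _+_ (x≡y+∂a σ) (u≡v+∂b σ) ⟩
    (coefficient y σ + ∂ (coeff a) σ) + (coefficient v σ + ∂ (coeff b) σ)
      ≡⟨ interchange (coefficient y σ) (∂ (coeff a) σ) (coefficient v σ) (∂ (coeff b) σ) ⟩
    (coefficient y σ + coefficient v σ) + (∂ (coeff a) σ + ∂ (coeff b) σ)
      ≡⟨ cong ((coefficient y σ + coefficient v σ) +_) (∂-+ (coeff a) (coeff b) σ) ⟨
    (coefficient y σ + coefficient v σ) + ∂ (coeff (+-chain a b)) σ
      ∎
    where
    open ≡-Reasoning
    interchange : ∀ p q r s → (p + q) + (r + s) ≡ (p + r) + (q + s)
    interchange = solve-∀

  neg-homologous : ∀ {k} {y z : Cycle k} →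
                   Homologous y z → Homologous (neg-cycle y) (neg-cycle z)
  neg-homologous {y = y} {z} (w , y≡z+∂w) = neg-chain w , λ σ → begin
    - coefficient y σ
      ≡⟨ cong -_ (y≡z+∂w σ) ⟩
    - (coefficient z σ + ∂ (coeff w) σ)
      ≡⟨ ℤ.neg-distrib-+ (coefficient z σ) _ ⟩
    - coefficient z σ + - ∂ (coeff w) σ
      ≡⟨ cong (- coefficient z σ +_) (∂-neg (coeff w) σ) ⟨
    - coefficient z σ + ∂ (-_ ∘ coeff w) σ
      ∎
    where open ≡-Reasoning

  reducedHomology : ℕ → AbelianGroup ℓ ℓ
  reducedHomology k = record
    { Carrier = Cycle k
    ; _≈_     = Homologous
    ; _∙_     = +-cycle
    ; ε       = 0-cycle
    ; _⁻¹     = neg-cycle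
    ; isAbelianGroup = record
      { isGroup = record
        { isMonoid = record
          { isSemigroup = record
            { isMagma = record
              { isEquivalence = record
                { refl  = λ {z} → ≗⇒homologous z z (λ _ → refl)
                ; sym   = λ {y z} → homologous-sym {y = y} {z}
                ; trans = λ {x y z} → homologous-trans {x = x} {y} {z}
                }
              ; ∙-cong = λ {x y u v} → +-homologous {x = x} {y} {u} {v}
              }
            ; assoc = λ x y z → ≗⇒homologous (+-cycle (+-cycle x y) z) (+-cycle x (+-cycle y z))
                (λ σ → ℤ.+-assoc (coefficient x σ) (coefficient y σ) (coefficient z σ))
            }
          ; identity =
              (λ z → ≗⇒homologous (+-cycle 0-cycle z) z (ℤ.+-identityˡ ∘ coefficient z))
            , (λ z → ≗⇒homologous (+-cycle z 0-cycle) z (ℤ.+-identityʳ ∘ coefficient z))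
          }
        ; inverse =
            (λ z → ≗⇒homologous (+-cycle (neg-cycle z) z) 0-cycle (ℤ.+-inverseˡ ∘ coefficient z))
          , (λ z → ≗⇒homologous (+-cycle z (neg-cycle z)) 0-cycle (ℤ.+-inverseʳ ∘ coefficient z))
        ; ⁻¹-cong = λ {y z} → neg-homologous {y = y} {z}
        }
      ; comm = λ y z → ≗⇒homologous (+-cycle y z) (+-cycle z y)
          (λ σ → ℤ.+-comm (coefficient y σ) (coefficient z σ))
      }
    }

Trivial : ∀ {a ℓ} → AbelianGroup a ℓ → Set (a ⊔ ℓ)
Trivial G = ∀ x → x ≈ ε
  where open AbelianGroup G

module _ (_≤_ : Rel (Fin n) ℓ) where

  -- The adjoined ⊤⁺ lies above any greatest element there may already be.
  AlmostJoinBased : Set ℓ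
  AlmostJoinBased = ∃ λ (_∨_ : Op₂ (Fin n ⁺)) → IsJoinSemilattice _≡_ (AddTop._≤⁺_ _≤_) _∨_

  IsChain : Subset n → Set ℓ
  IsChain σ = ∀ {x y} → x ∈ σ → y ∈ σ → x ≤ y ⊎ y ≤ x

  IsMaximalChain : Subset n → Set ℓ
  IsMaximalChain σ = IsChain σ × (∀ {τ} → IsChain τ → σ ⊆ τ → τ ≡ σ)

  orderComplex : SimplicialComplex n ℓ
  orderComplex = record
    { IsSimplex = IsChain
    ; ∅-simplex = λ x∈⊥ → contradiction x∈⊥ ∉⊥
    ; ⊆-closed  = λ σ⊆τ chain x∈σ y∈σ → chain (σ⊆τ x∈σ) (σ⊆τ y∈σ)
    }

-- An integer, because the empty chain has length -1.
chainLength : Subset n → ℤ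
chainLength σ = ∣ σ ∣ ⊖ 1

{-# OPTIONS --safe #-}

-- Let Q be an upset of P.  Either the order complex of Q has no homology in
-- dimension j - 1, or Q has (j + 1)! pairwise incompatible chains of j elements.
-- If the elements above some minimal a have no homology in dimension j - 2, then
-- by Mayer-Vietoris, applied to Q ∖ {a} and the cone above a, the element a can
-- be removed.  Otherwise each minimal element a adjoins to j! incompatible
-- chains above it, and there are at least j + 1 minimal elements: the upsets
-- they generate cover Q and, thanks to joins, their intersections are principal
-- or empty, so with at most j of them the homology would vanish.
module Submission where

open import Defs
open import Algebra.Properties.CommutativeMonoid.Sum as MonoidSum using ()
open import Algebra.Properties.Semiring.Sum as SemiringSum using ()
open import Data.Bool.Base using (true; false; if_then_else_)
open import Data.Fin.Base using (Fin; zero; suc)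
open import Data.Fin.Induction using (po-wellFounded)
open import Data.Fin.Properties using (all?; any?; ¬∀⟶∃¬)
open import Data.Fin.Subset using (Subset; ⊥; ⊤; ⁅_⁆; _∈_; _∉_; _⊆_; _⊂_; _∩_; _∪_; ∣_∣)
open import Data.Fin.Subset.Induction using (⊂-wellFounded)
open import Data.Fin.Subset.Properties
  using (∪-identityʳ; ∩-zeroʳ; ∣⊥∣≡0; p⊆p∪q; x∈p∪q⁻; x∈p∪q⁺; x∈⁅x⁆; x∈⁅y⁆⇒x≡y; _∈?_;
         ⊆-antisym; Empty-unique; ∉⊥; ∈⊤; p⊆q⇒∣p∣≤∣q∣)
open import Data.Integer.Base using (0ℤ)
import Data.Integer.Properties as ℤ
open import Data.Integer.Tactic.RingSolver using (solve-∀)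
open import Data.List.Base using (List; []; _∷_; _++_; map; filter; foldl; length; allFin)
import Data.List.Membership.Propositional as List
open import Data.List.Membership.Propositional.Properties using (∈-filter⁺; ∈-allFin)
open import Data.List.Properties using (length-++; length-map)
open import Data.List.Relation.Unary.All as All using (All; []; _∷_)
import Data.List.Relation.Unary.All.Properties as All
open import Data.List.Relation.Unary.AllPairs as AllPairs using (AllPairs; []; _∷_)
import Data.List.Relation.Unary.AllPairs.Properties as AllPairs
open import Data.List.Relation.Unary.Any as Any using (Any; here; there)
open import Data.List.Relation.Unary.Unique.Propositional using (Unique)
import Data.List.Relation.Unary.Unique.Propositional.Properties as Unique
open import Data.Nat.Base as ℕ using (ℕ; zero; suc; _!; _≥_; z≤n; s≤s)
import Data.Nat.Properties as ℕ
open import Data.Product.Base using (∃; _×_; _,_; proj₁; proj₂)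
open import Data.Sum.Base as Sum using (_⊎_; inj₁; inj₂)
open import Data.Vec.Base using ([]; _∷_; here; there; lookup; tabulate)
open import Data.Vec.Properties using (lookup⇒[]=; []=⇒lookup; lookup∘tabulate)
open import Function.Base using (_∘_; id; case_of_)
open import Induction.WellFounded using (Acc; acc)
open import Level using (Level; _⊔_)
open import Relation.Binary.Construct.Add.Supremum.NonStrict using ([_]; [≤]-injective)
open import Relation.Binary.Core using (Rel)
open import Relation.Binary.Lattice.Structures using (IsJoinSemilattice)
open import Relation.Binary.PropositionalEquality
  using (_≡_; _≢_; _≗_; refl; sym; trans; cong; cong₂; subst; subst₂; module ≡-Reasoning)
open import Relation.Binary.Structures using (IsDecPartialOrder)
open import Relation.Nullary.Construct.Add.Supremum using (⊤⁺; [_])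
open import Relation.Nullary.Decidable
  using (Dec; does; yes; no; dec-true; decidable-stable; ¬?; _×-dec_; _⊎-dec_; _→-dec_)
open import Relation.Nullary.Negation using (¬_; contradiction)
open import Relation.Unary using (Pred; Decidable)

private
  variable
    p q r s : Level
    n j : ℕ

-- Acyclic complexes

module Homology where
  open import Data.Integer.Base using (ℤ; -1ℤ; -_; _+_; _*_; _^_)
  open MonoidSum ℤ.+-0-commutativeMonoid using (sum; sum-cong-≗)
  open SemiringSum ℤ.+-*-semiring using (*-distribˡ-sum)

  -- The boundary operator by recursion on the vertices

  below-zero : ∀ n → below {suc n} zero ≡ ⊥
  below-zero n = tabulate-zero (suc n)
    where
    tabulate-zero : ∀ m → tabulate {n = m} (λ _ → false) ≡ ⊥
    tabulate-zero zero    = refl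
    tabulate-zero (suc m) = cong (false ∷_) (tabulate-zero m)

  ∣∩below-zero∣ : (σ : Subset (suc n)) → ∣ σ ∩ below zero ∣ ≡ 0
  ∣∩below-zero∣ {n} σ = trans (cong (λ τ → ∣ σ ∩ τ ∣) (below-zero n))
    (trans (cong ∣_∣ (∩-zeroʳ σ)) (∣⊥∣≡0 (suc n)))

  ∂-head : (c : Subset (suc n) → ℤ) (σ : Subset n) →
           (-1ℤ ^ ∣ (false ∷ σ) ∩ below zero ∣) * c ((false ∷ σ) ∪ ⁅ zero ⁆) ≡ c (true ∷ σ)
  ∂-head c σ = trans
    (cong₂ (λ i τ → (-1ℤ ^ i) * c (true ∷ τ)) (∣∩below-zero∣ (false ∷ σ)) (∪-identityʳ σ))
    (ℤ.*-identityˡ _)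

  -- A chain on Fin (suc n) is the pair of its values on the sets without and
  -- with zero, and in these coordinates ∂ is the mapping cone of the identity.
  ∂-false : (c : Subset (suc n) → ℤ) (σ : Subset n) →
            ∂ c (false ∷ σ) ≡ c (true ∷ σ) + ∂ (c ∘ (false ∷_)) σ
  ∂-false c σ = cong (_+ ∂ (c ∘ (false ∷_)) σ) (∂-head c σ)

  ∂-true : (c : Subset (suc n) → ℤ) (σ : Subset n) →
           ∂ c (true ∷ σ) ≡ - ∂ (c ∘ (true ∷_)) σ
  ∂-true {n} c σ = begin
    ∂ c (true ∷ σ)
      -- The summand of zero is 0. In the other summands zero is one more vertex below `suc v`,
      -- which gives the extra factor `-1ℤ`.
      ≡⟨ ℤ.+-identityˡ _ ⟩
    sum {n} (λ v → if lookup σ v then 0ℤ else (-1ℤ * -1ℤ ^ ∣ σ ∩ below v ∣) * c (true ∷ (σ ∪ ⁅ v ⁆)))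
      ≡⟨ sum-cong-≗ {n} term ⟩
    sum {n} (λ v → -1ℤ * (if lookup σ v then 0ℤ else (-1ℤ ^ ∣ σ ∩ below v ∣) * c (true ∷ (σ ∪ ⁅ v ⁆))))
      ≡⟨ *-distribˡ-sum {n} -1ℤ _ ⟨
    -1ℤ * ∂ (c ∘ (true ∷_)) σ
      ≡⟨ ℤ.-1*i≡-i _ ⟩
    - ∂ (c ∘ (true ∷_)) σ
      ∎
    where
    open ≡-Reasoning
    term : ∀ v →
      (if lookup σ v then 0ℤ else (-1ℤ * -1ℤ ^ ∣ σ ∩ below v ∣) * c (true ∷ (σ ∪ ⁅ v ⁆))) ≡
      -1ℤ * (if lookup σ v then 0ℤ else (-1ℤ ^ ∣ σ ∩ below v ∣) * c (true ∷ (σ ∪ ⁅ v ⁆)))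
    term v with lookup σ v
    ... | true  = refl
    ... | false = ℤ.*-assoc -1ℤ (-1ℤ ^ ∣ σ ∩ below v ∣) _

  -- Induction on the number of vertices: the two copies of `∂ c₁` cancel because putting zero in
  -- front reverses the sign of `∂`.
  ∂∘∂ : (c : Subset n → ℤ) (σ : Subset n) → ∂ (∂ c) σ ≡ 0ℤ
  ∂∘∂ c []          = refl
  ∂∘∂ c (false ∷ σ) = begin
    ∂ (∂ c) (false ∷ σ)
      ≡⟨ ∂-false (∂ c) σ ⟩
    ∂ c (true ∷ σ) + ∂ (∂ c ∘ (false ∷_)) σ
      ≡⟨ cong₂ _+_ (∂-true c σ) (∂-cong (∂-false c) σ) ⟩
    - ∂ c₁ σ + ∂ (λ τ → c₁ τ + ∂ c₀ τ) σ
      ≡⟨ cong (- ∂ c₁ σ +_) (∂-+ c₁ (∂ c₀) σ) ⟩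
    - ∂ c₁ σ + (∂ c₁ σ + ∂ (∂ c₀) σ)
      ≡⟨ cancel (∂ c₁ σ) (∂ (∂ c₀) σ) ⟩
    ∂ (∂ c₀) σ
      ≡⟨ ∂∘∂ c₀ σ ⟩
    0ℤ ∎
    where
    open ≡-Reasoning
    c₀ = c ∘ (false ∷_)
    c₁ = c ∘ (true ∷_)
    cancel : ∀ a b → - a + (a + b) ≡ b
    cancel = solve-∀
  ∂∘∂ c (true ∷ σ) = begin
    ∂ (∂ c) (true ∷ σ)           ≡⟨ ∂-true (∂ c) σ ⟩
    - ∂ (∂ c ∘ (true ∷_)) σ      ≡⟨ cong -_ (∂-cong (∂-true c) σ) ⟩
    - ∂ (λ τ → - ∂ c₁ τ) σ       ≡⟨ cong -_ (∂-neg (∂ c₁) σ) ⟩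
    - - ∂ (∂ c₁) σ               ≡⟨ cong (-_ ∘ -_) (∂∘∂ c₁ σ) ⟩
    0ℤ                           ∎
    where
    open ≡-Reasoning
    c₁ = c ∘ (true ∷_)

  -- Coning off a vertex

  -- cone v sends each simplex σ with v ∉ σ to ± σ ∪ {v}, the join with v in
  -- first place, and each simplex containing v to 0.
  cone : Fin n → (Subset n → ℤ) → (Subset n → ℤ)
  cone zero    c (false ∷ σ) = 0ℤ
  cone zero    c (true  ∷ σ) = c (false ∷ σ)
  cone (suc v) c (false ∷ σ) = cone v (c ∘ (false ∷_)) σ
  cone (suc v) c (true  ∷ σ) = - cone v (c ∘ (true ∷_)) σ

  cone-cong : (v : Fin n) {c d : Subset n → ℤ} → c ≗ d → cone v c ≗ cone v d
  cone-cong zero    c≗d (false ∷ σ) = refl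
  cone-cong zero    c≗d (true  ∷ σ) = c≗d (false ∷ σ)
  cone-cong (suc v) c≗d (false ∷ σ) = cone-cong v (c≗d ∘ (false ∷_)) σ
  cone-cong (suc v) c≗d (true  ∷ σ) = cong -_ (cone-cong v (c≗d ∘ (true ∷_)) σ)

  cone-+ : (v : Fin n) (c d : Subset n → ℤ) →
           cone v (λ σ → c σ + d σ) ≗ λ σ → cone v c σ + cone v d σ
  cone-+ zero    c d (false ∷ σ) = refl
  cone-+ zero    c d (true  ∷ σ) = refl
  cone-+ (suc v) c d (false ∷ σ) = cone-+ v _ _ σ
  cone-+ (suc v) c d (true  ∷ σ) = trans (cong -_ (cone-+ v _ _ σ)) (ℤ.neg-distrib-+ (cone v _ σ) _)

  cone-neg : (v : Fin n) (c : Subset n → ℤ) → cone v (λ σ → - c σ) ≗ λ σ → - cone v c σ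
  cone-neg zero    c (false ∷ σ) = refl
  cone-neg zero    c (true  ∷ σ) = refl
  cone-neg (suc v) c (false ∷ σ) = cone-neg v _ σ
  cone-neg (suc v) c (true  ∷ σ) = cong -_ (cone-neg v _ σ)

  cone-0 : (v : Fin n) {c : Subset n → ℤ} → (∀ σ → c σ ≡ 0ℤ) → ∀ σ → cone v c σ ≡ 0ℤ
  cone-0 zero    c≗0 (false ∷ σ) = refl
  cone-0 zero    c≗0 (true  ∷ σ) = c≗0 (false ∷ σ)
  cone-0 (suc v) c≗0 (false ∷ σ) = cone-0 v (c≗0 ∘ (false ∷_)) σ
  cone-0 (suc v) c≗0 (true  ∷ σ) = cong -_ (cone-0 v (c≗0 ∘ (true ∷_)) σ)

  -- `cone v` is a contracting homotopy of the augmented chain complex of the full simplex.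
  -- Induction on `v`: the signs in `cone (suc v)` are those of `∂-true`, so the mixed terms cancel.
  ∂-cone : (v : Fin n) (c : Subset n → ℤ) (σ : Subset n) →
           ∂ (cone v c) σ + cone v (∂ c) σ ≡ c σ
  ∂-cone {suc n} zero c (false ∷ σ) = begin
    ∂ (cone zero c) (false ∷ σ) + 0ℤ  ≡⟨ ℤ.+-identityʳ _ ⟩
    ∂ (cone zero c) (false ∷ σ)       ≡⟨ ∂-false (cone zero c) σ ⟩
    c (false ∷ σ) + ∂ {n} (λ _ → 0ℤ) σ    ≡⟨ cong (c (false ∷ σ) +_) (∂-0 σ) ⟩
    c (false ∷ σ) + 0ℤ                ≡⟨ ℤ.+-identityʳ _ ⟩
    c (false ∷ σ)                     ∎
    where open ≡-Reasoning
  ∂-cone zero c (true ∷ σ) = begin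
    ∂ (cone zero c) (true ∷ σ) + ∂ c (false ∷ σ)
      ≡⟨ cong₂ _+_ (∂-true (cone zero c) σ) (∂-false c σ) ⟩
    - ∂ (c ∘ (false ∷_)) σ + (c (true ∷ σ) + ∂ (c ∘ (false ∷_)) σ)
      ≡⟨ cancel (∂ (c ∘ (false ∷_)) σ) (c (true ∷ σ)) ⟩
    c (true ∷ σ)
      ∎
    where
    open ≡-Reasoning
    cancel : ∀ a b → - a + (b + a) ≡ b
    cancel = solve-∀
  ∂-cone (suc v) c (false ∷ σ) = begin
    ∂ (cone (suc v) c) (false ∷ σ) + cone v (∂ c ∘ (false ∷_)) σ
      ≡⟨ cong₂ _+_ (∂-false (cone (suc v) c) σ) (cone-cong v (∂-false c) σ) ⟩
    (- cone v c₁ σ + ∂ (cone v c₀) σ) + cone v (λ τ → c₁ τ + ∂ c₀ τ) σ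
      ≡⟨ cong ((- cone v c₁ σ + ∂ (cone v c₀) σ) +_) (cone-+ v c₁ (∂ c₀) σ) ⟩
    (- cone v c₁ σ + ∂ (cone v c₀) σ) + (cone v c₁ σ + cone v (∂ c₀) σ)
      ≡⟨ cancel (cone v c₁ σ) (∂ (cone v c₀) σ) (cone v (∂ c₀) σ) ⟩
    ∂ (cone v c₀) σ + cone v (∂ c₀) σ
      ≡⟨ ∂-cone v c₀ σ ⟩
    c₀ σ
      ∎
    where
    open ≡-Reasoning
    c₀ = c ∘ (false ∷_)
    c₁ = c ∘ (true ∷_)
    cancel : ∀ a b d → (- a + b) + (a + d) ≡ b + d
    cancel = solve-∀
  ∂-cone (suc v) c (true ∷ σ) = begin
    ∂ (cone (suc v) c) (true ∷ σ) + - cone v (∂ c ∘ (true ∷_)) σ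
      ≡⟨ cong₂ (λ a b → a + - b) (∂-true (cone (suc v) c) σ) (cone-cong v (∂-true c) σ) ⟩
    - ∂ (λ τ → - cone v c₁ τ) σ + - cone v (λ τ → - ∂ c₁ τ) σ
      ≡⟨ cong₂ (λ a b → - a + - b) (∂-neg (cone v c₁) σ) (cone-neg v (∂ c₁) σ) ⟩
    - - ∂ (cone v c₁) σ + - - cone v (∂ c₁) σ
      ≡⟨ cong₂ _+_ (ℤ.neg-involutive (∂ (cone v c₁) σ)) (ℤ.neg-involutive (cone v (∂ c₁) σ)) ⟩
    ∂ (cone v c₁) σ + cone v (∂ c₁) σ
      ≡⟨ ∂-cone v c₁ σ ⟩
    c₁ σ
      ∎
    where
    open ≡-Reasoning
    c₁ = c ∘ (true ∷_)

  neg≢0 : ∀ {i} → - i ≢ 0ℤ → i ≢ 0ℤ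
  neg≢0 -i≢0 i≡0 = -i≢0 (cong -_ i≡0)

  +≢0 : ∀ i k → i + k ≢ 0ℤ → i ≢ 0ℤ ⊎ k ≢ 0ℤ
  +≢0 i k i+k≢0 with i ℤ.≟ 0ℤ
  ... | no  i≢0  = inj₁ i≢0
  ... | yes refl = inj₂ (i+k≢0 ∘ trans (ℤ.+-identityˡ k))

  -- Carries support conditions through `∂`: if `c` lives on a complex closed under subsets, so does
  -- `∂ c`, with one vertex less.
  ∂-support : (c : Subset n → ℤ) (σ : Subset n) → ∂ c σ ≢ 0ℤ →
              ∃ λ τ → c τ ≢ 0ℤ × σ ⊆ τ × ∣ τ ∣ ≡ suc ∣ σ ∣
  ∂-support c []          ∂c≢0 = contradiction refl ∂c≢0
  ∂-support c (false ∷ σ) ∂c≢0 with +≢0 _ _ (∂c≢0 ∘ trans (∂-false c σ))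
  ... | inj₁ c≢0 = true ∷ σ , c≢0 , (λ { (there x∈σ) → there x∈σ }) , refl
  ... | inj₂ ∂c₀≢0 with ∂-support (c ∘ (false ∷_)) σ ∂c₀≢0
  ...   | τ , c≢0 , σ⊆τ , ∣τ∣ = false ∷ τ , c≢0 , (λ { (there x∈σ) → there (σ⊆τ x∈σ) }) , ∣τ∣
  ∂-support c (true ∷ σ) ∂c≢0 with ∂-support (c ∘ (true ∷_)) σ (neg≢0 (∂c≢0 ∘ trans (∂-true c σ)))
  ... | τ , c≢0 , σ⊆τ , ∣τ∣ =
    true ∷ τ , c≢0 , (λ { here → here ; (there x∈σ) → there (σ⊆τ x∈σ) }) , cong suc ∣τ∣

  cone-support : (v : Fin n) (c : Subset n → ℤ) (σ : Subset n) → cone v c σ ≢ 0ℤ →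
                 ∃ λ τ → c τ ≢ 0ℤ × (∀ {x} → x ∈ σ → x ≡ v ⊎ x ∈ τ) × ∣ σ ∣ ≡ suc ∣ τ ∣
  cone-support zero    c (false ∷ σ) 0≢0 = contradiction refl 0≢0
  cone-support zero    c (true  ∷ σ) c≢0 =
    false ∷ σ , c≢0 , (λ { here → inj₁ refl ; (there x∈σ) → inj₂ (there x∈σ) }) , refl
  cone-support (suc v) c (false ∷ σ) cone≢0 with cone-support v (c ∘ (false ∷_)) σ cone≢0
  ... | τ , c≢0 , σ⊆ , ∣σ∣ =
    false ∷ τ , c≢0 , (λ { (there x∈σ) → Sum.map (cong suc) there (σ⊆ x∈σ) }) , ∣σ∣
  cone-support (suc v) c (true  ∷ σ) cone≢0 with cone-support v (c ∘ (true ∷_)) σ (neg≢0 cone≢0)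
  ... | τ , c≢0 , σ⊆ , ∣σ∣ =
    true ∷ τ , c≢0
    , (λ { here → inj₂ here ; (there x∈σ) → Sum.map (cong suc) there (σ⊆ x∈σ) }) , cong suc ∣σ∣

  -- Acyclicity, cones and Mayer-Vietoris

  ChainOn : Pred (Subset n) p → ℕ → Pred (Subset n → ℤ) p
  ChainOn K j c = ∀ σ → c σ ≢ 0ℤ → K σ × ∣ σ ∣ ≡ j

  -- Indexed by the number of vertices: Acyclic K j is the vanishing of reduced
  -- homology in dimension j - 1.
  Acyclic : Pred (Subset n) p → ℕ → Set p
  Acyclic K j = ∀ z → ChainOn K j z → (∀ σ → ∂ z σ ≡ 0ℤ) →
                ∃ λ w → ChainOn K (suc j) w × z ≗ ∂ w

  ChainOn-mono : {K : Pred (Subset n) p} {L : Pred (Subset n) q} →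
                 (∀ {σ} → K σ → L σ) → ∀ {c} → ChainOn K j c → ChainOn L j c
  ChainOn-mono K⊆L c-on σ cσ≢0 = K⊆L (proj₁ (c-on σ cσ≢0)) , proj₂ (c-on σ cσ≢0)

  ChainOn-+ : {K : Pred (Subset n) p} {c d : Subset n → ℤ} →
              ChainOn K j c → ChainOn K j d → ChainOn K j (λ σ → c σ + d σ)
  ChainOn-+ {c = c} {d} c-on d-on σ c+d≢0 =
    Sum.[ c-on σ , d-on σ ] (+≢0 (c σ) (d σ) c+d≢0)

  ChainOn-neg : {K : Pred (Subset n) p} {c : Subset n → ℤ} →
                ChainOn K j c → ChainOn K j (λ σ → - c σ)
  ChainOn-neg c-on σ -c≢0 = c-on σ (neg≢0 -c≢0)

  Acyclic-resp : {K : Pred (Subset n) p} {L : Pred (Subset n) q} →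
                 (∀ {σ} → K σ → L σ) → (∀ {σ} → L σ → K σ) → Acyclic K j → Acyclic L j
  Acyclic-resp K⊆L L⊆K acyclic z z-on ∂z≡0 =
    let w , w-on , z≗∂w = acyclic z (ChainOn-mono L⊆K z-on) ∂z≡0
    in  w , ChainOn-mono K⊆L w-on , z≗∂w

  -- The closure hypothesis makes `K` a cone with apex `v`. For a cycle `z` the term `cone v (∂ z)`
  -- of `∂-cone` vanishes, so `z` bounds `cone v z`.
  cone-acyclic : {K : Pred (Subset n) p} (v : Fin n) →
                 (∀ {σ τ} → K τ → (∀ {x} → x ∈ σ → x ≡ v ⊎ x ∈ τ) → K σ) → Acyclic K j
  cone-acyclic {K = K} v closed z z-on ∂z≡0 = cone v z , on , bounds
    where
    on : ChainOn K _ (cone v z)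
    on σ cone≢0 =
      let τ , z≢0 , σ⊆ , ∣σ∣ = cone-support v z σ cone≢0
          Kτ , ∣τ∣ = z-on τ z≢0
      in  closed Kτ σ⊆ , trans ∣σ∣ (cong suc ∣τ∣)
    bounds : z ≗ ∂ (cone v z)
    bounds σ = begin
      z σ                                ≡⟨ ∂-cone v z σ ⟨
      ∂ (cone v z) σ + cone v (∂ z) σ    ≡⟨ cong (∂ (cone v z) σ +_) (cone-0 v ∂z≡0 σ) ⟩
      ∂ (cone v z) σ + 0ℤ                ≡⟨ ℤ.+-identityʳ _ ⟩
      ∂ (cone v z) σ                     ∎
      where open ≡-Reasoning

  -- Exactness at the homology of the union. Split `z` as `z₁ + z₂`; then `∂ z₁` is a cycle on the
  -- intersection `L`, so it bounds some `y` there. Now `z₁ - y` and `z₂ + y` are cycles on `K₁` and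
  -- `K₂`, and their fillings add up to one of `z`.
  mayerVietoris :
    {K : Pred (Subset n) p} {K₁ : Pred (Subset n) q}
    {K₂ : Pred (Subset n) r} {L : Pred (Subset n) s} →
    (∀ {σ τ} → σ ⊆ τ → K₁ τ → K₁ σ) → (∀ {σ τ} → σ ⊆ τ → K₂ τ → K₂ σ) →
    (∀ {σ} → K₁ σ → K σ) → (∀ {σ} → K₂ σ → K σ) →
    (∀ {σ} → K σ → K₁ σ ⊎ K₂ σ) →
    (∀ {σ} → L σ → K₁ σ × K₂ σ) → (∀ {σ} → K₁ σ → K₂ σ → L σ) →
    Acyclic K₁ (suc j) → Acyclic K₂ (suc j) → Acyclic L j → Acyclic K (suc j)
  mayerVietoris {j = j} {K = K} {K₁} {K₂} {L} K₁-closed K₂-closed K₁⊆K K₂⊆K cover L⊆ ⊆L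
    acyclic₁ acyclic₂ acyclic z z-on ∂z≡0 = result
    where
    open ≡-Reasoning

    -- A simplex of both pieces goes where `cover` sends it. Where `z` vanishes, `σ` need not be in
    -- `K` and both parts are 0.
    split : ∀ σ → ∃ λ a → ∃ λ b → z σ ≡ a + b ×
            (a ≢ 0ℤ → K₁ σ × ∣ σ ∣ ≡ suc j) × (b ≢ 0ℤ → K₂ σ × ∣ σ ∣ ≡ suc j)
    split σ with z σ ℤ.≟ 0ℤ
    ... | yes z≡0 = 0ℤ , 0ℤ , z≡0 , contradiction refl , contradiction refl
    ... | no  z≢0 with z-on σ z≢0
    ...   | Kσ , ∣σ∣ with cover Kσ
    ...     | inj₁ K₁σ = z σ , 0ℤ , sym (ℤ.+-identityʳ _) , (λ _ → K₁σ , ∣σ∣) , contradiction refl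
    ...     | inj₂ K₂σ = 0ℤ , z σ , sym (ℤ.+-identityˡ _) , contradiction refl , (λ _ → K₂σ , ∣σ∣)

    z₁ z₂ : Subset _ → ℤ
    z₁ σ = proj₁ (split σ)
    z₂ σ = proj₁ (proj₂ (split σ))

    z≡z₁+z₂ : ∀ σ → z σ ≡ z₁ σ + z₂ σ
    z≡z₁+z₂ σ = proj₁ (proj₂ (proj₂ (split σ)))

    z₁-on : ChainOn K₁ (suc j) z₁
    z₁-on σ = proj₁ (proj₂ (proj₂ (proj₂ (split σ))))

    z₂-on : ChainOn K₂ (suc j) z₂
    z₂-on σ = proj₂ (proj₂ (proj₂ (proj₂ (split σ))))

    ∂z₁≡-∂z₂ : ∀ σ → ∂ z₁ σ ≡ - ∂ z₂ σ
    ∂z₁≡-∂z₂ σ = begin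
      ∂ z₁ σ                            ≡⟨ cancel (∂ z₁ σ) (∂ z₂ σ) ⟩
      (∂ z₁ σ + ∂ z₂ σ) + - ∂ z₂ σ      ≡⟨ cong (_+ - ∂ z₂ σ) (∂-+ z₁ z₂ σ) ⟨
      ∂ (λ τ → z₁ τ + z₂ τ) σ + - ∂ z₂ σ  ≡⟨ cong (_+ - ∂ z₂ σ) (∂-cong z≡z₁+z₂ σ) ⟨
      ∂ z σ + - ∂ z₂ σ                  ≡⟨ cong (_+ - ∂ z₂ σ) (∂z≡0 σ) ⟩
      0ℤ + - ∂ z₂ σ                     ≡⟨ ℤ.+-identityˡ _ ⟩
      - ∂ z₂ σ                          ∎
      where
      cancel : ∀ a b → a ≡ (a + b) + - b
      cancel = solve-∀

    -- Since `∂ z₁` and `∂ z₂` are opposite, they are nonzero at the same `σ`, which is then a face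
    -- of simplices from both pieces.
    ∂z₁-on : ChainOn L j (∂ z₁)
    ∂z₁-on σ ∂z₁≢0 =
      let τ₁ , z₁≢0 , σ⊆τ₁ , ∣τ₁∣ = ∂-support z₁ σ ∂z₁≢0
          τ₂ , z₂≢0 , σ⊆τ₂ , _    = ∂-support z₂ σ (neg≢0 (∂z₁≢0 ∘ trans (∂z₁≡-∂z₂ σ)))
          K₁τ₁ , ∣τ₁∣′ = z₁-on τ₁ z₁≢0
          K₂τ₂ , _     = z₂-on τ₂ z₂≢0
      in  ⊆L (K₁-closed σ⊆τ₁ K₁τ₁) (K₂-closed σ⊆τ₂ K₂τ₂) , ℕ.suc-injective (trans (sym ∣τ₁∣) ∣τ₁∣′)

    result : ∃ λ w → ChainOn K (suc (suc j)) w × z ≗ ∂ w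
    result =
      let y , y-on , ∂z₁≗∂y = acyclic (∂ z₁) ∂z₁-on (∂∘∂ z₁)
          w₁ , w₁-on , eq₁ = acyclic₁ (λ σ → z₁ σ + - y σ)
            (ChainOn-+ z₁-on (ChainOn-neg (ChainOn-mono (proj₁ ∘ L⊆) y-on)))
            (λ σ → begin
              ∂ (λ τ → z₁ τ + - y τ) σ     ≡⟨ ∂-+ z₁ (-_ ∘ y) σ ⟩
              ∂ z₁ σ + ∂ (-_ ∘ y) σ        ≡⟨ cong₂ _+_ (∂z₁≗∂y σ) (∂-neg y σ) ⟩
              ∂ y σ + - ∂ y σ              ≡⟨ ℤ.+-inverseʳ (∂ y σ) ⟩
              0ℤ                           ∎)
          w₂ , w₂-on , eq₂ = acyclic₂ (λ σ → z₂ σ + y σ)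
            (ChainOn-+ z₂-on (ChainOn-mono (proj₂ ∘ L⊆) y-on))
            (λ σ → begin
              ∂ (λ τ → z₂ τ + y τ) σ       ≡⟨ ∂-+ z₂ y σ ⟩
              ∂ z₂ σ + ∂ y σ               ≡⟨ cong (∂ z₂ σ +_) (∂z₁≗∂y σ) ⟨
              ∂ z₂ σ + ∂ z₁ σ              ≡⟨ cong (∂ z₂ σ +_) (∂z₁≡-∂z₂ σ) ⟩
              ∂ z₂ σ + - ∂ z₂ σ            ≡⟨ ℤ.+-inverseʳ (∂ z₂ σ) ⟩
              0ℤ                           ∎)
      in  (λ σ → w₁ σ + w₂ σ)
        , ChainOn-+ (ChainOn-mono K₁⊆K w₁-on) (ChainOn-mono K₂⊆K w₂-on)
        , λ σ → begin
            z σ                            ≡⟨ z≡z₁+z₂ σ ⟩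
            z₁ σ + z₂ σ                    ≡⟨ regroup (z₁ σ) (z₂ σ) (y σ) ⟩
            (z₁ σ + - y σ) + (z₂ σ + y σ)  ≡⟨ cong₂ _+_ (eq₁ σ) (eq₂ σ) ⟩
            ∂ w₁ σ + ∂ w₂ σ                ≡⟨ ∂-+ w₁ w₂ σ ⟨
            ∂ (λ τ → w₁ τ + w₂ τ) σ        ∎
      where
      regroup : ∀ a b d → a + b ≡ (a + - d) + (b + d)
      regroup = solve-∀

open Homology
open import Data.Integer.Base using (+_; _⊖_) renaming (_≤_ to _≤ℤ_)
open import Data.Nat.Base using (_+_; _*_)

-- Chains in upsets

⟦_⟧ : {P : Pred (Fin n) p} → Decidable P → Subset n
⟦ P? ⟧ = tabulate (does ∘ P?)

∈⟦⟧⁺ : {P : Pred (Fin n) p} (P? : Decidable P) {x : Fin n} → P x → x ∈ ⟦ P? ⟧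
∈⟦⟧⁺ P? {x} Px = lookup⇒[]= x _ (trans (lookup∘tabulate (does ∘ P?) x) (dec-true (P? x) Px))

∈⟦⟧⁻ : {P : Pred (Fin n) p} (P? : Decidable P) {x : Fin n} → x ∈ ⟦ P? ⟧ → P x
∈⟦⟧⁻ P? {x} x∈ with P? x | trans (sym (lookup∘tabulate (does ∘ P?) x)) ([]=⇒lookup x∈)
... | yes Px | _ = Px

∣σ∪⁅x⁆∣ : (σ : Subset n) {x : Fin n} → x ∉ σ → ∣ σ ∪ ⁅ x ⁆ ∣ ≡ suc ∣ σ ∣
∣σ∪⁅x⁆∣ (true  ∷ σ) {zero}  x∉σ = contradiction here x∉σ
∣σ∪⁅x⁆∣ (false ∷ σ) {zero}  x∉σ = cong (suc ∘ ∣_∣) (∪-identityʳ σ)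
∣σ∪⁅x⁆∣ (true  ∷ σ) {suc x} x∉σ = cong suc (∣σ∪⁅x⁆∣ σ (x∉σ ∘ there))
∣σ∪⁅x⁆∣ (false ∷ σ) {suc x} x∉σ = ∣σ∪⁅x⁆∣ σ (x∉σ ∘ there)

x∈σ∪⁅v⁆⁻ : (σ : Subset n) (v : Fin n) {x : Fin n} → x ∈ σ ∪ ⁅ v ⁆ → x ≡ v ⊎ x ∈ σ
x∈σ∪⁅v⁆⁻ σ v x∈ = Sum.[ inj₂ , inj₁ ∘ x∈⁅y⁆⇒x≡y v ] (x∈p∪q⁻ σ ⁅ v ⁆ x∈)

v∈σ∪⁅v⁆ : (σ : Subset n) (v : Fin n) → v ∈ σ ∪ ⁅ v ⁆
v∈σ∪⁅v⁆ σ v = x∈p∪q⁺ (inj₂ (x∈⁅x⁆ v))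

module _ {ℓ} {n : ℕ} {_≤_ : Rel (Fin n) ℓ} (isDecPartialOrder : IsDecPartialOrder _≡_ _≤_) where
  private module P = IsDecPartialOrder isDecPartialOrder
  open P using (_≤?_; _≟_)

  Comparable : Rel (Fin n) ℓ
  Comparable x y = x ≤ y ⊎ y ≤ x

  comparable? : ∀ x y → Dec (Comparable x y)
  comparable? x y = (x ≤? y) ⊎-dec (y ≤? x)

  _<_ : Rel (Fin n) ℓ
  x < y = x ≤ y × x ≢ y

  _<?_ : ∀ x y → Dec (x < y)
  x <? y = (x ≤? y) ×-dec ¬? (x ≟ y)

  adjoin-chain : ∀ {σ τ v} → IsChain _≤_ τ → (∀ {x} → x ∈ τ → Comparable v x) →
                 (∀ {x} → x ∈ σ → x ≡ v ⊎ x ∈ τ) → IsChain _≤_ σ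
  adjoin-chain τ-chain v~ σ⊆ x∈σ y∈σ with σ⊆ x∈σ | σ⊆ y∈σ
  ... | inj₁ refl | inj₁ refl = inj₁ P.refl
  ... | inj₁ refl | inj₂ y∈τ  = v~ y∈τ
  ... | inj₂ x∈τ  | inj₁ refl = Sum.swap (v~ x∈τ)
  ... | inj₂ x∈τ  | inj₂ y∈τ  = τ-chain x∈τ y∈τ

  -- Greedy extension to a maximal chain

  compatible? : ∀ σ v → Dec (∀ x → x ∈ σ → Comparable v x)
  compatible? σ v = all? λ x → (x ∈? σ) →-dec comparable? v x

  extendBy : Subset n → Fin n → Subset n
  extendBy σ v with compatible? σ v
  ... | yes _ = σ ∪ ⁅ v ⁆
  ... | no  _ = σ

  extendBy-⊆ : ∀ σ v → σ ⊆ extendBy σ v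
  extendBy-⊆ σ v with compatible? σ v
  ... | yes _ = p⊆p∪q ⁅ v ⁆
  ... | no  _ = id

  extendBy-chain : ∀ {σ} v → IsChain _≤_ σ → IsChain _≤_ (extendBy σ v)
  extendBy-chain {σ} v chain with compatible? σ v
  ... | yes v~ = adjoin-chain chain (v~ _) (x∈σ∪⁅v⁆⁻ σ v)
  ... | no  _  = chain

  extendBy-∈ : ∀ {σ} v → (∀ {x} → x ∈ extendBy σ v → Comparable v x) → v ∈ extendBy σ v
  extendBy-∈ {σ} v v~ with compatible? σ v
  ... | yes _  = v∈σ∪⁅v⁆ σ v
  ... | no ¬v~ = contradiction (λ _ → v~) ¬v~

  extendByAll : Subset n → List (Fin n) → Subset n
  extendByAll = foldl extendBy

  extendByAll-⊆ : ∀ σ vs → σ ⊆ extendByAll σ vs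
  extendByAll-⊆ σ []       = id
  extendByAll-⊆ σ (v ∷ vs) = extendByAll-⊆ (extendBy σ v) vs ∘ extendBy-⊆ σ v

  extendByAll-chain : ∀ {σ} vs → IsChain _≤_ σ → IsChain _≤_ (extendByAll σ vs)
  extendByAll-chain []       chain = chain
  extendByAll-chain (v ∷ vs) chain = extendByAll-chain vs (extendBy-chain v chain)

  -- When the turn of `v` comes, the set built so far is part of the final one, so `v` is comparable
  -- with all of it and is adjoined.
  extendByAll-∈ : ∀ {σ v} {vs : List (Fin n)} → v List.∈ vs →
                  (∀ {x} → x ∈ extendByAll σ vs → Comparable v x) → v ∈ extendByAll σ vs
  extendByAll-∈ {σ} {v} {_ ∷ vs} (here refl)  v~ =
    extendByAll-⊆ _ vs (extendBy-∈ v (v~ ∘ extendByAll-⊆ _ vs))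
  extendByAll-∈         {vs = _ ∷ _}  (there v∈vs) v~ = extendByAll-∈ v∈vs v~

  extension : Subset n → Subset n
  extension σ = extendByAll σ (allFin n)

  -- An element of a larger chain is comparable with the whole extension, so the greedy pass has
  -- already adjoined it.
  extension-maximal : ∀ {σ} → IsChain _≤_ σ → IsMaximalChain _≤_ (extension σ)
  extension-maximal chain =
      extendByAll-chain (allFin n) chain
    , λ τ-chain ext⊆τ → ⊆-antisym
        (λ v∈τ → extendByAll-∈ (∈-allFin _) (λ x∈ext → τ-chain v∈τ (ext⊆τ x∈ext)))
        ext⊆τ

  -- Order complexes of parts of the poset

  ChainIn : Pred (Fin n) p → Pred (Subset n) (ℓ ⊔ p)
  ChainIn Q σ = IsChain _≤_ σ × (∀ {x} → x ∈ σ → Q x)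

  ChainIn-mono : {Q : Pred (Fin n) p} {R : Pred (Fin n) q} → (∀ {x} → Q x → R x) →
                 ∀ {σ} → ChainIn Q σ → ChainIn R σ
  ChainIn-mono Q⊆R (chain , σ⊆Q) = chain , λ x∈σ → Q⊆R (σ⊆Q x∈σ)

  -- The cover is a condition on chains, not on elements: every chain has to lie entirely in one of
  -- the two parts.
  ChainIn-mayerVietoris :
    {Q : Pred (Fin n) p} {Q₁ : Pred (Fin n) q} {Q₂ : Pred (Fin n) r} {Q₁₂ : Pred (Fin n) s} →
    (∀ {x} → Q₁ x → Q x) → (∀ {x} → Q₂ x → Q x) →
    (∀ {σ} → ChainIn Q σ → ChainIn Q₁ σ ⊎ ChainIn Q₂ σ) →
    (∀ {x} → Q₁₂ x → Q₁ x × Q₂ x) → (∀ {x} → Q₁ x → Q₂ x → Q₁₂ x) →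
    Acyclic (ChainIn Q₁) (suc j) → Acyclic (ChainIn Q₂) (suc j) → Acyclic (ChainIn Q₁₂) j →
    Acyclic (ChainIn Q) (suc j)
  ChainIn-mayerVietoris Q₁⊆Q Q₂⊆Q cover Q₁₂⊆ ⊆Q₁₂ =
    mayerVietoris closed closed (ChainIn-mono Q₁⊆Q) (ChainIn-mono Q₂⊆Q) cover
      (λ c → ChainIn-mono (proj₁ ∘ Q₁₂⊆) c , ChainIn-mono (proj₂ ∘ Q₁₂⊆) c)
      (λ (chain , σ⊆Q₁) (_ , σ⊆Q₂) → chain , λ x∈σ → ⊆Q₁₂ (σ⊆Q₁ x∈σ) (σ⊆Q₂ x∈σ))
    where
    closed : ∀ {t} {R : Pred (Fin n) t} {σ τ} → σ ⊆ τ → ChainIn R τ → ChainIn R σ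
    closed σ⊆τ (chain , τ⊆R) = (λ x∈σ y∈σ → chain (σ⊆τ x∈σ) (σ⊆τ y∈σ)) , λ x∈σ → τ⊆R (σ⊆τ x∈σ)

  -- A principal upset has a least element, so its order complex is a cone with apex `a`.
  above-acyclic : ∀ a → Acyclic (ChainIn (a ≤_)) j
  above-acyclic a = cone-acyclic a λ {σ} {τ} (chain , a≤) σ⊆ →
      adjoin-chain chain (inj₁ ∘ a≤) σ⊆
    , λ x∈σ → Sum.[ P.reflexive ∘ sym , a≤ ] (σ⊆ x∈σ)

  -- Minimal elements

  minimal : Subset n → Pred (Fin n) ℓ
  minimal Q x = x ∈ Q × (∀ y → y ∈ Q → y ≤ x → y ≡ x)

  minimal? : ∀ Q → Decidable (minimal Q)
  minimal? Q x = (x ∈? Q) ×-dec all? λ y → (y ∈? Q) →-dec ((y ≤? x) →-dec (y ≟ x))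

  minimals : Subset n → List (Fin n)
  minimals Q = filter (minimal? Q) (allFin n)

  minimals-minimal : ∀ Q → All (minimal Q) (minimals Q)
  minimals-minimal Q = All.all-filter (minimal? Q) (allFin n)

  minimals-unique : ∀ Q → Unique (minimals Q)
  minimals-unique Q = Unique.filter⁺ (minimal? Q) (Unique.allFin⁺ n)

  above-minimal : ∀ Q {x} → x ∈ Q → Any (_≤ x) (minimals Q)
  above-minimal Q {x} = go x (po-wellFounded P.isPartialOrder x)
    where
    go : ∀ x → Acc _<_ x → x ∈ Q → Any (_≤ x) (minimals Q)
    go x (acc rec) x∈Q with any? (λ y → (y ∈? Q) ×-dec (y <? x))
    ... | yes (y , y∈Q , y<x) = Any.map (λ a≤y → P.trans a≤y (proj₁ y<x)) (go y (rec y<x) y∈Q)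
    ... | no ¬below = Any.map (P.reflexive ∘ sym) (∈-filter⁺ (minimal? Q) (∈-allFin x) (x∈Q , min))
      where
      min : ∀ y → y ∈ Q → y ≤ x → y ≡ x
      min y y∈Q y≤x with y ≟ x
      ... | yes y≡x = y≡x
      ... | no  y≢x = contradiction (y , y∈Q , y≤x , y≢x) ¬below

  -- Families of incompatible chains

  -- A witness that no chain contains both `σ` and `τ`. Unlike mere distinctness, this survives
  -- enlarging either of them.
  Incompatible : Rel (Subset n) ℓ
  Incompatible σ τ = ∃ λ x → ∃ λ y → x ∈ σ × y ∈ τ × ¬ Comparable x y

  -- Incompatible chains have distinct maximal extensions.
  IncompatibleChains : Pred (Fin n) p → (j m : ℕ) → Set (ℓ ⊔ p)
  IncompatibleChains Q j m = ∃ λ σs →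
    All (λ σ → ChainIn Q σ × ∣ σ ∣ ≡ j) σs × AllPairs Incompatible σs × length σs ≥ m

  IncompatibleChains-mono : {Q : Pred (Fin n) p} {R : Pred (Fin n) q} {m : ℕ} →
    (∀ {x} → Q x → R x) → IncompatibleChains Q j m → IncompatibleChains R j m
  IncompatibleChains-mono Q⊆R (σs , σs-in , rest) =
    σs , All.map (λ (σ-in , ∣σ∣) → ChainIn-mono Q⊆R σ-in , ∣σ∣) σs-in , rest

  -- Chains that receive the same `a` stay incompatible. Chains that receive different elements are
  -- incompatible through these elements; the component `Any (_∈ σ) as` remembers them for the
  -- induction.
  adjoinMinimals : {Q : Pred (Fin n) p} {m : ℕ} (as : List (Fin n)) →
    All Q as → (∀ {a x} → a < x → Q a → Q x) →
    AllPairs (λ a b → ¬ Comparable a b) as → All (λ a → IncompatibleChains (a <_) j m) as →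
    ∃ λ σs → All (λ σ → (ChainIn Q σ × ∣ σ ∣ ≡ suc j) × Any (_∈ σ) as) σs ×
             AllPairs Incompatible σs × length σs ≥ length as * m
  adjoinMinimals [] _ _ _ _ = [] , [] , [] , z≤n
  adjoinMinimals {j = j} {Q = Q} {m} (a ∷ as) (Qa ∷ Qas) up (a≁as ∷ as-antichain)
    ((σs , σs-in , σs-inc , m≤) ∷ fams) =
    let τs , τs-in , τs-inc , m*≤ = adjoinMinimals as Qas up as-antichain fams
    in  σs⁺ ++ τs
      , All.++⁺ (All.map (λ (σ-in , a∈σ) → σ-in , here a∈σ) σs⁺-in)
                (All.map (λ (τ-in , as∈τ) → τ-in , there as∈τ) τs-in)
      , AllPairs.++⁺
          (AllPairs.map⁺ (AllPairs.map
            (λ (x , y , x∈σ , y∈τ , x≁y) → x , y , p⊆p∪q ⁅ a ⁆ x∈σ , p⊆p∪q ⁅ a ⁆ y∈τ , x≁y) σs-inc))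
          τs-inc
          (All.map (λ (_ , a∈σ) → All.map (λ (_ , as∈τ) →
            let a≁b , b∈τ = All.lookupAny a≁as as∈τ in a , _ , a∈σ , b∈τ , a≁b) τs-in) σs⁺-in)
      , (begin
          m + length as * m         ≤⟨ ℕ.+-mono-≤ m≤ m*≤ ⟩
          length σs + length τs     ≡⟨ cong (_+ length τs) (length-map (_∪ ⁅ a ⁆) σs) ⟨
          length σs⁺ + length τs    ≡⟨ length-++ σs⁺ ⟨
          length (σs⁺ ++ τs)          ∎)
    where
    open ℕ.≤-Reasoning
    adjoined : ∀ {σ} → ChainIn (a <_) σ × ∣ σ ∣ ≡ j →
               (ChainIn Q (σ ∪ ⁅ a ⁆) × ∣ σ ∪ ⁅ a ⁆ ∣ ≡ suc j) × a ∈ σ ∪ ⁅ a ⁆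
    adjoined {σ} ((chain , a<) , ∣σ∣) =
      ( ( adjoin-chain chain (inj₁ ∘ proj₁ ∘ a<) (x∈σ∪⁅v⁆⁻ σ a)
        , λ x∈ → Sum.[ (λ { refl → Qa }) , (λ x∈σ → up (a< x∈σ) Qa) ] (x∈σ∪⁅v⁆⁻ σ a x∈))
      , trans (∣σ∪⁅x⁆∣ σ (λ a∈σ → proj₂ (a< a∈σ) refl)) (cong suc ∣σ∣))
      , v∈σ∪⁅v⁆ σ a
    σs⁺ : List (Subset n)
    σs⁺ = map (_∪ ⁅ a ⁆) σs
    σs⁺-in : All (λ σ → (ChainIn Q σ × ∣ σ ∣ ≡ suc j) × a ∈ σ) σs⁺
    σs⁺-in = All.map⁺ (All.map adjoined σs-in)

  UpClosed : Pred (Subset n) ℓ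
  UpClosed Q = ∀ {x y} → x ∈ Q → x ≤ y → y ∈ Q

  -- Unions of few principal upsets

  module _ (almostJoinBased : AlmostJoinBased _≤_) where

    -- If the join in the extended poset is `⊤⁺`, a common upper bound inside the poset would have
    -- to lie above `⊤⁺`.
    join : ∀ a b → (∃ λ c → a ≤ c × b ≤ c × (∀ {x} → a ≤ x → b ≤ x → c ≤ x)) ⊎
                   (∀ {x} → a ≤ x → ¬ b ≤ x)
    join a b with proj₁ almostJoinBased [ a ] [ b ]
                | IsJoinSemilattice.supremum (proj₂ almostJoinBased) [ a ] [ b ]
    ... | [ c ] | [ a≤c ] , [ b≤c ] , least =
      inj₁ (c , a≤c , b≤c , λ a≤x b≤x → [≤]-injective _≤_ (least [ _ ] [ a≤x ] [ b≤x ]))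
    ... | ⊤⁺    | _ , _ , least = inj₂ λ a≤x b≤x → case least [ _ ] [ a≤x ] [ b≤x ] of λ ()

    -- The upset of `a` meets the upset generated by `as` in the upset generated by those joins of
    -- `a` with members of `as` that exist. The length bound feeds the induction in `upset-acyclic`.
    joins : ∀ a as → ∃ λ bs → length bs ℕ.≤ length as ×
      (∀ {x} → Any (_≤ x) bs → a ≤ x × Any (_≤ x) as) ×
      (∀ {x} → a ≤ x → Any (_≤ x) as → Any (_≤ x) bs)
    joins a [] = [] , z≤n , (λ ()) , λ _ ()
    joins a (a′ ∷ as) with join a a′ | joins a as
    ... | inj₁ (c , a≤c , a′≤c , least) | bs , bs≤as , to , from =
        c ∷ bs , s≤s bs≤as
      , (λ { (here c≤x)  → P.trans a≤c c≤x , here (P.trans a′≤c c≤x)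
           ; (there bs≤x) → proj₁ (to bs≤x) , there (proj₂ (to bs≤x)) })
      , (λ { a≤x (here a′≤x)  → here (least a≤x a′≤x)
           ; a≤x (there as≤x) → there (from a≤x as≤x) })
    ... | inj₂ unbounded | bs , bs≤as , to , from =
        bs , ℕ.m≤n⇒m≤1+n bs≤as
      , (λ bs≤x → proj₁ (to bs≤x) , there (proj₂ (to bs≤x)))
      , (λ { a≤x (here a′≤x)  → contradiction a′≤x (unbounded a≤x)
           ; a≤x (there as≤x) → from a≤x as≤x })

    -- Mayer-Vietoris for the cone above `a` and the upset of `as`. Their intersection has at most
    -- as many generators as `as`, one less than the list `a ∷ as`, which matches the drop in
    -- dimension. The index is a successor because the empty upset has homology at index 0.
    upset-acyclic : ∀ j as → length as ℕ.≤ suc j → Acyclic (ChainIn (λ x → Any (_≤ x) as)) (suc j)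
    upset-acyclic j [] _ z z-on _ =
        (λ _ → 0ℤ) , (λ _ → contradiction refl) , λ σ → trans (z≗0 σ) (sym (∂-0 σ))
      where
      -- The only chain in the empty upset is `⊥`, which has too few vertices to support `z`.
      z≗0 : ∀ σ → z σ ≡ 0ℤ
      z≗0 σ = decidable-stable (z σ ℤ.≟ 0ℤ) λ z≢0 →
        let (_ , σ⊆) , ∣σ∣ = z-on σ z≢0
            σ≡⊥ = Empty-unique λ (x , x∈σ) → case σ⊆ x∈σ of λ ()
        in  case trans (sym ∣σ∣) (trans (cong ∣_∣ σ≡⊥) (∣⊥∣≡0 n)) of λ ()
    upset-acyclic zero (a ∷ []) _ =
      Acyclic-resp (ChainIn-mono here) (ChainIn-mono λ { (here a≤x) → a≤x }) (above-acyclic a)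
    upset-acyclic zero (a ∷ _ ∷ _) (s≤s ())
    upset-acyclic (suc j) (a ∷ as) (s≤s as≤) =
      let bs , bs≤as , to , from = joins a as
      in  ChainIn-mayerVietoris here there cover to from
            (above-acyclic a) (upset-acyclic (suc j) as (ℕ.m≤n⇒m≤1+n as≤))
            (upset-acyclic j bs (ℕ.≤-trans bs≤as as≤))
      where
      -- If some `x` of the chain is not above `a`, it is above a member of `as`. A `y` of the chain
      -- with `a ≤ y` cannot lie below `x`, so it is above `x` and above the same member.
      cover : ∀ {σ} → ChainIn (λ x → Any (_≤ x) (a ∷ as)) σ →
              ChainIn (a ≤_) σ ⊎ ChainIn (λ x → Any (_≤ x) as) σ
      cover {σ} (chain , σ⊆) with all? (λ x → (x ∈? σ) →-dec (a ≤? x))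
      ... | yes a≤ = inj₁ (chain , a≤ _)
      ... | no ¬a≤ = let x , ¬x = ¬∀⟶∃¬ n _ (λ x → (x ∈? σ) →-dec (a ≤? x)) ¬a≤
                     in  inj₂ (chain , above x ¬x)
        where
        above : ∀ x → ¬ (x ∈ σ → a ≤ x) → ∀ {y} → y ∈ σ → Any (_≤ y) as
        above x ¬x {y} y∈σ with x ∈? σ
        ... | no  x∉σ = contradiction (λ x∈σ → contradiction x∈σ x∉σ) ¬x
        ... | yes x∈σ with σ⊆ x∈σ | σ⊆ y∈σ | chain x∈σ y∈σ
        ...   | here a≤x | _ | _ = contradiction (λ _ → a≤x) ¬x
        ...   | there as≤x | there as≤y | _ = as≤y
        ...   | there as≤x | here a≤y | inj₁ x≤y = Any.map (λ b≤x → P.trans b≤x x≤y) as≤x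
        ...   | there as≤x | here a≤y | inj₂ y≤x = contradiction (λ _ → P.trans a≤y y≤x) ¬x

    -- The main induction

    -- Outer induction on `j`, inner induction on `Q` under strict inclusion. The upset varies so
    -- that the claim applies both to the elements strictly above some `a` and to `Q` without `a`.
    acyclic⊎incompatible : ∀ j Q → UpClosed Q →
      Acyclic (ChainIn (_∈ Q)) j ⊎ IncompatibleChains (_∈ Q) j (suc j !)
    acyclic⊎incompatible zero Q _ =
      -- The empty chain alone suffices, as `1 !` is 1.
      inj₂ ( ⊥ ∷ []
           , (((λ x∈⊥ → contradiction x∈⊥ ∉⊥) , λ x∈⊥ → contradiction x∈⊥ ∉⊥) , ∣⊥∣≡0 n) ∷ []
           , [] ∷ []
           , s≤s z≤n)
    acyclic⊎incompatible (suc j) Q = go Q (⊂-wellFounded Q)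
      where
      above : ∀ a → Acyclic (ChainIn (a <_)) j ⊎ IncompatibleChains (a <_) j (suc j !)
      above a = Sum.map
        (Acyclic-resp (ChainIn-mono (∈⟦⟧⁻ (a <?_))) (ChainIn-mono (∈⟦⟧⁺ (a <?_))))
        (IncompatibleChains-mono (∈⟦⟧⁻ (a <?_)))
        (acyclic⊎incompatible j ⟦ a <?_ ⟧ λ x∈ x≤y →
          let a≤x , a≢x = ∈⟦⟧⁻ (a <?_) x∈
          in  ∈⟦⟧⁺ (a <?_) (P.trans a≤x x≤y , λ { refl → a≢x (P.antisym a≤x x≤y) }))

      go : ∀ Q → Acc _⊂_ Q → UpClosed Q →
           Acyclic (ChainIn (_∈ Q)) (suc j) ⊎ IncompatibleChains (_∈ Q) (suc j) (suc (suc j) !)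
      -- Acyclicity is not decided here: the outer induction hypothesis supplies the alternative at
      -- each minimal element.
      go Q (acc rec) up with All.decide (Sum.swap ∘ above) (minimals Q)
      ... | inj₂ some = remove (List.find some)
        where
        remove : (∃ λ a → a List.∈ minimals Q × Acyclic (ChainIn (a <_)) j) →
                 Acyclic (ChainIn (_∈ Q)) (suc j) ⊎ IncompatibleChains (_∈ Q) (suc j) (suc (suc j) !)
        remove (a , a∈ , acyclic) with All.lookup (minimals-minimal Q) a∈
        -- `Q` is covered by `R`, that is `Q` without `a`, and the cone above `a`; they meet in the
        -- elements strictly above `a`. So acyclicity passes from `R` to `Q`, and chains in `R` are
        -- chains in `Q`.
        ... | a∈Q , a-min = Sum.map
            (λ acyclic′ → ChainIn-mayerVietoris R⊆Q (up a∈Q) cover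
              (λ (a≤x , a≢x) → ∈⟦⟧⁺ R? (up a∈Q a≤x , a≢x) , a≤x)
              (λ x∈R a≤x → a≤x , proj₂ (∈⟦⟧⁻ R? x∈R))
              acyclic′ (above-acyclic a) acyclic)
            (IncompatibleChains-mono R⊆Q)
            (go R (rec R⊂Q) R-up)
          where
          R? : Decidable (λ x → x ∈ Q × a ≢ x)
          R? x = (x ∈? Q) ×-dec ¬? (a ≟ x)
          R = ⟦ R? ⟧
          R⊆Q : R ⊆ Q
          R⊆Q = proj₁ ∘ ∈⟦⟧⁻ R?
          R⊂Q : R ⊂ Q
          R⊂Q = R⊆Q , a , a∈Q , λ a∈R → proj₂ (∈⟦⟧⁻ R? a∈R) refl
          R-up : UpClosed R
          R-up x∈R x≤y = let x∈Q , a≢x = ∈⟦⟧⁻ R? x∈R in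
            ∈⟦⟧⁺ R? (up x∈Q x≤y , λ { refl → a≢x (sym (a-min _ x∈Q x≤y)) })
          -- By minimality of `a`, a chain in `Q` through `a` lies above `a`.
          cover : ∀ {σ} → ChainIn (_∈ Q) σ → ChainIn (_∈ R) σ ⊎ ChainIn (a ≤_) σ
          cover {σ} (chain , σ⊆Q) with a ∈? σ
          ... | no  a∉σ = inj₁ (chain , λ x∈σ → ∈⟦⟧⁺ R? (σ⊆Q x∈σ , λ { refl → a∉σ x∈σ }))
          ... | yes a∈σ = inj₂ (chain , λ x∈σ →
            Sum.[ id , (λ x≤a → P.reflexive (sym (a-min _ (σ⊆Q x∈σ) x≤a))) ] (chain a∈σ x∈σ))
      ... | inj₁ fams with length (minimals Q) ℕ.≤? suc j
      ...   | yes few = inj₁ (Acyclic-resp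
                (ChainIn-mono λ as≤x →
                  let (a∈Q , _) , a≤x = All.lookupAny (minimals-minimal Q) as≤x in up a∈Q a≤x)
                (ChainIn-mono (above-minimal Q))
                (upset-acyclic j (minimals Q) few))
      -- At least `suc (suc j)` minimal elements with `suc j !` chains each: the product is
      -- `suc (suc j) !` by definition.
      ...   | no many =
        let σs , σs-in , σs-inc , ≤∣σs∣ =
              adjoinMinimals (minimals Q) (All.map proj₁ (minimals-minimal Q))
                (λ (a≤x , _) a∈Q → up a∈Q a≤x) antichain fams
        in  inj₂ (σs , All.map proj₁ σs-in , σs-inc
                 , ℕ.≤-trans (ℕ.*-monoˡ-≤ (suc j !) (ℕ.≰⇒> many)) ≤∣σs∣)
        where
        antichain : AllPairs (λ a b → ¬ Comparable a b) (minimals Q)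
        antichain = distinct (minimals-minimal Q) (minimals-unique Q)
          where
          distinct : ∀ {as} → All (minimal Q) as → Unique as → AllPairs (λ a b → ¬ Comparable a b) as
          distinct [] [] = []
          distinct ((a∈Q , a-min) ∷ mins) (a≢as ∷ uniq) =
            All.zipWith (λ ((b∈Q , b-min) , a≢b) →
              Sum.[ a≢b ∘ b-min _ a∈Q , a≢b ∘ sym ∘ a-min _ b∈Q ]) (mins , a≢as)
            ∷ distinct mins uniq

-- From incompatible chains to maximal chains

AllPairs-zipWith-All : {A : Set p} {P : Pred A q} {R : Rel A r} {S : Rel A s} →
                       (∀ {x y} → P x → R x y → S x y) →
                       ∀ {xs} → All P xs → AllPairs R xs → AllPairs S xs
AllPairs-zipWith-All f []         []         = []
AllPairs-zipWith-All f (px ∷ pxs) (rx ∷ rxs) = All.map (f px) rx ∷ AllPairs-zipWith-All f pxs rxs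

theorem26 : ∀ {ℓ : Level} (n : ℕ) (_≤_ : Rel (Fin n) ℓ) →
    IsDecPartialOrder _≡_ _≤_ →
    AlmostJoinBased _≤_ →
    (k : ℕ) →
    ¬ Trivial (reducedHomology (orderComplex _≤_) k) →
    ∃ λ (chains : List (Subset n)) →
    Unique chains ×
    All (λ σ → IsMaximalChain _≤_ σ × (+ k) ≤ℤ chainLength σ) chains ×
    length chains ≥ (k + 2) !
-- Dimension `k` is index `suc k`, and the whole poset is the upset `⊤`.
theorem26 n _≤_ po ajb k nontrivial with acyclic⊎incompatible po ajb (suc k) ⊤ (λ _ _ → ∈⊤)
... | inj₁ acyclic = contradiction trivial nontrivial
  where
  open Cycle
  trivial : Trivial (reducedHomology (orderComplex _≤_) k)
  trivial z =
    let w , w-on , z≗∂w = acyclic (coefficient z)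
          (λ σ c≢0 → let chain , ∣σ∣ = SimplicialChain.supported (chain z) σ c≢0
                     in  (chain , λ _ → ∈⊤) , ∣σ∣)
          (closed z)
    in  record { coeff     = w
               ; supported = λ σ w≢0 → let (chain , _) , ∣σ∣ = w-on σ w≢0 in chain , ∣σ∣ }
      , λ σ → trans (z≗∂w σ) (sym (ℤ.+-identityˡ _))
... | inj₂ (σs , σs-in , σs-inc , ≤∣σs∣) =
    map ext σs
  , AllPairs.map⁺ (AllPairs-zipWith-All distinct σs-in σs-inc)
  , All.map⁺ (All.map maximal σs-in)
  , subst₂ _≥_ (sym (length-map ext σs)) (cong _! (ℕ.+-comm 2 k)) ≤∣σs∣
  where
  ext = extension po
  ext-⊆ : ∀ σ → σ ⊆ ext σ
  ext-⊆ σ = extendByAll-⊆ po σ (allFin n)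
  maximal : ∀ {σ} → ChainIn po (_∈ ⊤) σ × ∣ σ ∣ ≡ suc k →
            IsMaximalChain _≤_ (ext σ) × (+ k) ≤ℤ chainLength (ext σ)
  maximal {σ} ((chain , _) , ∣σ∣) = extension-maximal po chain ,
    (begin
      + k              ≡⟨ cong (_⊖ 1) ∣σ∣ ⟨
      ∣ σ ∣ ⊖ 1        ≤⟨ ℤ.⊖-monoˡ-≤ 1 (p⊆q⇒∣p∣≤∣q∣ (ext-⊆ σ)) ⟩
      ∣ ext σ ∣ ⊖ 1    ∎)
    where open ℤ.≤-Reasoning
  distinct : ∀ {σ τ} → ChainIn po (_∈ ⊤) σ × ∣ σ ∣ ≡ suc k → Incompatible po σ τ → ext σ ≢ ext τ
  distinct {σ} {τ} ((chain , _) , _) (x , y , x∈σ , y∈τ , x≁y) eq =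
    -- If the two extensions agreed, a single chain would contain the incomparable `x` and `y`.
    x≁y (proj₁ (extension-maximal po chain) (ext-⊆ σ x∈σ) (subst (y ∈_) (sym eq) (ext-⊆ τ y∈τ)))
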